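{- Let $\mathsf{L}'$, $\mathsf{L}$, $\mathsf{H}'$, $\mathsf{H}$ be simplicial complexes, and let $\mathsf{L}'\to\mathsf{L}$ and $\mathsf{H}'\to\mathsf{H}$ be facet simplicial maps. (1) We have $$\mathrm{C}(\mathsf{L}';\mathsf{H})\leq \mathrm{C}(\mathsf{L};\mathsf{H})\leq \mathrm{C}(\mathsf{L};\mathsf{H}').$$ (2) Moreover, if $\mathsf{L}'\to\mathsf{L}$ and $\mathsf{H}'\to\mathsf{H}$ are injective, then $$\mathrm{IC}(\mathsf{L}';\mathsf{H})\leq \mathrm{IC}(\mathsf{L};\mathsf{H})\leq \mathrm{IC}(\mathsf{L};\mathsf{H}').$$
   Context: A simplicial complex is an abstract simplicial complex: a set $\mathsf{K}$ of subsets (simplices) of a vertex set $V(\mathsf{K})=\bigcup\mathsf{K}$ such that $F\in\mathsf{K}$ and $G\subseteq F$ imply $G\in\mathsf{K}$. A facet is a simplex that is maximal with respect to inclusion; a facet is non-unitary if it has at least two vertices. A subcomplex of $\mathsf{K}$ is a simplicial complex contained in $\mathsf{K}$. The union of simplicial complexes is the union of their vertex sets and of their sets of simplices. A simplicial map $f:\mathsf{L}\to\mathsf{K}$ is a map $f:V(\mathsf{L})\to V(\mathsf{K})$ such that $f(F)\in\mathsf{K}$ whenever $F\in\mathsf{L}$; it is injective if it is injective on vertices. A facet simplicial map is a simplicial map $f:\mathsf{L}\to\mathsf{K}$ such that $f(F)$ is a non-unitary facet of $\mathsf{K}$ whenever $F$ is a non-unitary facet of $\mathsf{L}$. The facet-complexity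 $\mathrm{C}(\mathsf{L};\mathsf{K})$ is the least positive integer $k$ such that there exist subcomplexes $\mathsf{L}_1,\ldots,\mathsf{L}_k$ of $\mathsf{L}$ with $\mathsf{L}=\mathsf{L}_1\cup\cdots\cup\mathsf{L}_k$ and, for each $i$, a facet simplicial map $f_i:\mathsf{L}_i\to\mathsf{K}$; it is $\infty$ if no such $k$ exists. The injective facet-complexity $\mathrm{IC}(\mathsf{L};\mathsf{K})$ is defined in the same way, requiring each $f_i$ to be an injective facet simplicial map. -}

module Defs where

open import Axiom.ExcludedMiddle using (ExcludedMiddle)
open import Data.Fin.Base using (Fin)
open import Data.Irrelevant using ([_])
open import Data.Nat.Base using (ℕ; zero; suc; _≤_; _<_)
open import Data.Nat.Properties using (≮⇒≥; m<1+n⇒m<n∨m≡n)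
open import Data.Product.Base using (Σ; ∃; Σ-syntax; ∃-syntax; _×_; _,_; proj₁; proj₂)
open import Data.Refinement.Base using (Refinement; Refinement-syntax; _,_; value)
open import Data.Sum.Base using (_⊎_; inj₁; inj₂)
open import Function.Definitions using (Injective)
open import Level using (Level; _⊔_) renaming (suc to lsuc)
open import Relation.Binary.PropositionalEquality.Core using (_≡_; _≢_; refl)
open import Relation.Nullary.Construct.Add.Supremum using (_⁺; ⊤⁺) renaming ([_] to fin)
open import Relation.Nullary.Decidable.Core using (yes; no)
open import Relation.Nullary.Negation.Core using (¬_)
open import Relation.Unary using (Pred; _∈_; _⊆_; _≐_)

private
  variable
    ℓ : Level
    X Y : Set ℓ

-- X is only a type from which vertices are drawn: the vertex set is ⋃K (see
-- V below), which may be smaller than X.  Simplices are arbitrary subsets of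
-- X, possibly infinite or empty.  As G ⊆ F is extensional, down-closed also
-- makes the family invariant under extensional equality of subsets.
record Complex (X : Set ℓ) : Set (lsuc (lsuc ℓ)) where
  field
    Simplex     : Pred (Pred X ℓ) (lsuc ℓ)
    down-closed : ∀ {F G} → F ∈ Simplex → G ⊆ F → G ∈ Simplex

open Complex public

V : Complex X → Pred X _
V K x = ∃[ F ] F ∈ Simplex K × x ∈ F

-- The membership proof is irrelevant, so two vertices are equal as soon as
-- their underlying points are.
Vertex : {X : Set ℓ} → Complex X → Set (lsuc ℓ)
Vertex {X = X} K = [ x ∈ X ∣ x ∈ V K ]

IsFacet : {X : Set ℓ} → Complex X → Pred (Pred X ℓ) (lsuc ℓ)
IsFacet K F = F ∈ Simplex K × (∀ {G} → G ∈ Simplex K → F ⊆ G → G ⊆ F)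

NonUnitary : {X : Set ℓ} → Pred (Pred X ℓ) ℓ
NonUnitary F = ∃[ x ] ∃[ y ] x ∈ F × y ∈ F × x ≢ y

IsNonUnitaryFacet : {X : Set ℓ} → Complex X → Pred (Pred X ℓ) (lsuc ℓ)
IsNonUnitaryFacet K F = IsFacet K F × NonUnitary F

_⊑_ : {X : Set ℓ} → Complex X → Complex X → Set (lsuc ℓ)
L ⊑ K = Simplex L ⊆ Simplex K

-- Equality as sets of simplices; the vertex sets then agree as well.
_≈_ : {X : Set ℓ} → Complex X → Complex X → Set (lsuc ℓ)
L ≈ K = Simplex L ≐ Simplex K

⋃ : ∀ {k} → (Fin k → Complex X) → Complex X
⋃ L .Simplex F = ∃[ i ] F ∈ Simplex (L i)
⋃ L .down-closed (i , F∈Lᵢ) G⊆F = i , down-closed (L i) F∈Lᵢ G⊆F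

module _ {X Y : Set ℓ} {L : Complex X} {K : Complex Y} where

  -- The set f(F) ⊆ Y.  F ∈ L is needed only to see points of F as vertices.
  image : (Vertex L → Vertex K) → ∀ {F} → F ∈ Simplex L → Pred Y ℓ
  image f {F} F∈L y = ∃[ x ] Σ[ x∈F ∈ x ∈ F ] value (f (x , [ F , F∈L , x∈F ])) ≡ y

  IsSimplicial : (Vertex L → Vertex K) → Set (lsuc ℓ)
  IsSimplicial f = ∀ {F} (F∈L : F ∈ Simplex L) → image f F∈L ∈ Simplex K

  PreservesNonUnitaryFacets : (Vertex L → Vertex K) → Set (lsuc ℓ)
  PreservesNonUnitaryFacets f =
    ∀ {F} (F∈L : F ∈ Simplex L) →
    IsNonUnitaryFacet L F → IsNonUnitaryFacet K (image f F∈L)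

record FacetMap {X Y : Set ℓ} (L : Complex X) (K : Complex Y) : Set (lsuc ℓ) where
  field
    fun                       : Vertex L → Vertex K
    simplicial                : IsSimplicial {L = L} {K} fun
    preservesNonUnitaryFacets : PreservesNonUnitaryFacets {L = L} {K} fun

open FacetMap public

IsInjective : {X Y : Set ℓ} {L : Complex X} {K : Complex Y} →
              FacetMap L K → Set (lsuc ℓ)
IsInjective f = Injective _≡_ _≡_ (fun f)

InjFacetMap : {X Y : Set ℓ} → Complex X → Complex Y → Set (lsuc ℓ)
InjFacetMap L K = Σ (FacetMap L K) IsInjective

-- L = L₁ ∪ ⋯ ∪ L_k with each Lᵢ a subcomplex carrying an element of M Lᵢ.
CoverBy : {X : Set ℓ} → (Complex X → Set (lsuc ℓ)) → Complex X → ℕ → Set (lsuc (lsuc ℓ))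
CoverBy {X = X} M L k =
  Σ[ Lᵢ ∈ (Fin k → Complex X) ] (∀ i → Lᵢ i ⊑ L) × L ≈ ⋃ Lᵢ × (∀ i → M (Lᵢ i))

-- ℕ ⁺ is ℕ ∪ {∞}, with ∞ written ⊤⁺.
IsLeast : ∀ {p} → Pred ℕ p → ℕ ⁺ → Set p
IsLeast P (fin k) = P k × (∀ {j} → P j → k ≤ j)
IsLeast P ⊤⁺      = ∀ k → ¬ P k

-- The minimum of an undecidable set of naturals need not exist
-- constructively, hence excluded middle.
least : ∀ {p} → ExcludedMiddle p → (P : Pred ℕ p) → ∃ (IsLeast P)
least em P with em {∃ P}
... | no ¬∃P       = ⊤⁺ , λ k Pk → ¬∃P (k , Pk)
... | yes (n , Pn) = finish (search n)
  where
  search : ∀ n → (∃[ k ] P k × (∀ {j} → P j → k ≤ j)) ⊎ (∀ {j} → j < n → ¬ P j)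
  search zero    = inj₂ λ ()
  search (suc n) with search n
  ... | inj₁ found = inj₁ found
  ... | inj₂ none with em {P n}
  ...   | yes Pn = inj₁ (n , Pn , λ Pj → ≮⇒≥ λ j<n → none j<n Pj)
  ...   | no ¬Pn = inj₂ λ j<1+n Pj → case (m<1+n⇒m<n∨m≡n j<1+n) Pj
    where
    case : ∀ {j} → j < n ⊎ j ≡ n → ¬ P j
    case (inj₁ j<n)  Pj = none j<n Pj
    case (inj₂ refl) Pj = ¬Pn Pj

  finish : (∃[ k ] P k × (∀ {j} → P j → k ≤ j)) ⊎ (∀ {j} → j < n → ¬ P j) → ∃ (IsLeast P)
  finish (inj₁ (k , least-k)) = fin k , least-k
  finish (inj₂ none)          = fin n , Pn , λ Pj → ≮⇒≥ λ j<n → none j<n Pj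

module _ {ℓ} (em : ExcludedMiddle (lsuc (lsuc ℓ))) {X Y : Set ℓ} where

  C : Complex X → Complex Y → ℕ ⁺
  C L K = proj₁ (least em λ k → 0 < k × CoverBy (λ Lᵢ → FacetMap Lᵢ K) L k)

  IC : Complex X → Complex Y → ℕ ⁺
  IC L K = proj₁ (least em λ k → 0 < k × CoverBy (λ Lᵢ → InjFacetMap Lᵢ K) L k)

{-# OPTIONS --safe #-}

-- Covers of L by complexes that map to H′ are pushed along H′ → H by
-- composition.  In the other direction, pulling a cover Lᵢ back along
-- φ : L′ → L to φ⁻¹(Lᵢ) is not enough: a facet of φ⁻¹(Lᵢ) need not be a facet
-- of L′, so its image under φ need not be a facet of Lᵢ.  Instead one keeps
-- only the simplices F of φ⁻¹(Lᵢ) lying in some G ∈ L′ all of whose extensions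
-- in L′ belong to φ⁻¹(Lᵢ).  Every facet of this smaller complex is a facet of
-- L′.  The smaller complexes still cover L′: if F has an extension outside
-- φ⁻¹(L₁), then no extension of that one is in φ⁻¹(L₁), and one argues by
-- induction on the number of pieces.  When each simplex lies in a facet, this
-- is the cover by the facets F of L′ with φ(F) ∈ Lᵢ; the argument also covers
-- infinite complexes, where there may be no facets at all.
module Submission where

open import Defs
open import Axiom.DoubleNegationElimination using (em⇒dne)
open import Axiom.ExcludedMiddle using (ExcludedMiddle)
open import Data.Empty using (⊥-elim)
open import Data.Fin.Base using (Fin)
import Data.Irrelevant as Irrelevant
open import Data.Nat.Base using (ℕ; _≤_)
open import Data.Product.Base using (∃-syntax; _×_; _,_; proj₁; proj₂; map₂)
open import Data.Refinement.Base using (_,_; value; refine)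
open import Data.Refinement.Properties using (value-injective)
open import Function.Base using (_∘_; id)
open import Level using (Level; suc; lift; lower)
open import Relation.Binary.Construct.Add.Supremum.NonStrict _≤_ using (_≤⁺_; [_]; _≤⊤⁺)
open import Relation.Binary.PropositionalEquality.Core using (refl; cong)
open import Relation.Nullary.Construct.Add.Supremum using (⊤⁺) renaming ([_] to fin)
open import Relation.Nullary.Decidable.Core using (yes; no; map′)
open import Relation.Unary using (Pred; _∈_; _∉_; _⊆_; _≐_)

private
  variable
    ℓ : Level
    X : Set ℓ

IsLeast-antitone : ∀ {p} {P Q : Pred ℕ p} → Q ⊆ P →
                   ∀ {a b} → IsLeast P a → IsLeast Q b → a ≤⁺ b
IsLeast-antitone Q⊆P {a}     {⊤⁺}    _           _        = a ≤⊤⁺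
IsLeast-antitone Q⊆P {⊤⁺}    {fin k} ¬P          (Qk , _) = ⊥-elim (¬P k (Q⊆P Qk))
IsLeast-antitone Q⊆P {fin _} {fin _} (_ , least) (Qk , _) = [ least (Q⊆P Qk) ]

least-antitone : ∀ {p} (em : ExcludedMiddle p) {P Q : Pred ℕ p} → Q ⊆ P →
                 proj₁ (least em P) ≤⁺ proj₁ (least em Q)
least-antitone em {P} {Q} Q⊆P =
  IsLeast-antitone Q⊆P (proj₂ (least em P)) (proj₂ (least em Q))

lower-em : ExcludedMiddle (suc ℓ) → ExcludedMiddle ℓ
lower-em em = map′ lower lift em

-- Subsets are predicates, and the image under a composite map agrees with the iterated image only
-- extensionally.
IsNonUnitaryFacet-resp-≐ : {K : Complex X} {F G : Pred X _} → F ≐ G →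
                           IsNonUnitaryFacet K F → IsNonUnitaryFacet K G
IsNonUnitaryFacet-resp-≐ {K = K} (F⊆G , G⊆F) ((F∈K , max) , x , y , x∈F , y∈F , x≢y) =
  (down-closed K F∈K G⊆F , λ H∈K G⊆H z∈H → F⊆G (max H∈K (G⊆H ∘ F⊆G) z∈H)) ,
  x , y , F⊆G x∈F , F⊆G y∈F , x≢y

IsFacet-⊑ : {K L : Complex X} {F : Pred X _} → L ⊑ K → F ∈ Simplex L →
            IsFacet K F → IsFacet L F
IsFacet-⊑ L⊑K F∈L (_ , max) = F∈L , λ G∈L → max (L⊑K G∈L)

V-mono : {K L : Complex X} → L ⊑ K → V L ⊆ V K
V-mono L⊑K (F , F∈L , x∈F) = F , L⊑K F∈L , x∈F

module _ {ℓ} {X Y Z : Set ℓ} {K : Complex X} {L : Complex Y} {M : Complex Z} where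

  infixr 9 _∘ᶠ_

  _∘ᶠ_ : FacetMap L M → FacetMap K L → FacetMap K M
  (g ∘ᶠ f) .fun = fun g ∘ fun f
  (g ∘ᶠ f) .simplicial F∈K =
    down-closed M (simplicial g (simplicial f F∈K))
      λ { (x , x∈F , eq) → _ , (x , x∈F , refl) , eq }
  (g ∘ᶠ f) .preservesNonUnitaryFacets F∈K facet =
    IsNonUnitaryFacet-resp-≐ {K = M}
      ( (λ { (_ , (x , x∈F , refl) , eq) → x , x∈F , eq })
      , (λ { (x , x∈F , eq) → _ , (x , x∈F , refl) , eq }))
      (preservesNonUnitaryFacets g (simplicial f F∈K)
        (preservesNonUnitaryFacets f F∈K facet))

  _∘ⁱ_ : InjFacetMap L M → InjFacetMap K L → InjFacetMap K M
  (g , g-inj) ∘ⁱ (f , f-inj) = g ∘ᶠ f , f-inj ∘ g-inj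

persistent : {X : Set ℓ} → Complex X → Complex X → Complex X
persistent K D .Simplex F =
  ∃[ G ] G ∈ Simplex K × F ⊆ G × (∀ {H} → H ∈ Simplex K → G ⊆ H → H ∈ Simplex D)
persistent K D .down-closed (G , G∈K , F⊆G , above) E⊆F = G , G∈K , F⊆G ∘ E⊆F , above

module _ {ℓ} {X : Set ℓ} (K : Complex X) where

  persistent-⊑ˡ : (D : Complex X) → persistent K D ⊑ K
  persistent-⊑ˡ D (_ , G∈K , F⊆G , _) = down-closed K G∈K F⊆G

  persistent-⊑ʳ : (D : Complex X) → persistent K D ⊑ D
  persistent-⊑ʳ D (_ , G∈K , F⊆G , above) = down-closed D (above G∈K id) F⊆G

  -- The witness `G` is itself in `persistent K D`, so maximality of `F` gives `G ⊆ F`. Every `H` in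
  -- `K` above `F` is then above `G`, hence again in `persistent K D`, and maximality applies a
  -- second time.
  persistent-facet : (D : Complex X) → IsFacet (persistent K D) ⊆ IsFacet K
  persistent-facet D (F∈P@(G , G∈K , F⊆G , above) , max) =
    persistent-⊑ˡ D F∈P ,
    λ {H} H∈K F⊆H →
      let G⊆F = max (G , G∈K , id , above) F⊆G
      in max (H , H∈K , id , λ I∈K H⊆I → above I∈K (H⊆I ∘ F⊆H ∘ G⊆F)) F⊆H

  -- Induction on `k`. The covering hypothesis concerns only simplices above `F`, so it can pass to
  -- an escaping `G` above `F` with one piece fewer.
  persistent-cover-above :
    ExcludedMiddle (suc ℓ) → ∀ {k} (D : Fin k → Complex X) {F} → F ∈ Simplex K →
    (∀ {G} → G ∈ Simplex K → F ⊆ G → ∃[ i ] G ∈ Simplex (D i)) →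
    ∃[ i ] F ∈ Simplex (persistent K (D i))
  persistent-cover-above em {ℕ.zero} D F∈K cover with () ← proj₁ (cover F∈K id)
  persistent-cover-above em {ℕ.suc k} D {F} F∈K cover
    with em {∃[ G ] G ∈ Simplex K × F ⊆ G × G ∉ Simplex (D Fin.zero)}
  ... | no ¬escape =
        Fin.zero , F , F∈K , id ,
        λ {H} H∈K F⊆H → em⇒dne em λ H∉D₀ → ¬escape (H , H∈K , F⊆H , H∉D₀)
  ... | yes (G , G∈K , F⊆G , G∉D₀) =
        let i , G∈P = persistent-cover-above em (D ∘ Fin.suc) G∈K cover′
        in Fin.suc i , down-closed (persistent K (D (Fin.suc i))) G∈P F⊆G
    where
    cover′ : ∀ {H} → H ∈ Simplex K → G ⊆ H → ∃[ i ] H ∈ Simplex (D (Fin.suc i))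
    cover′ H∈K G⊆H with cover H∈K (G⊆H ∘ F⊆G)
    -- By closure under subsets, an extension of `G` in the first piece would put `G` there too.
    ... | Fin.zero  , H∈D₀ = ⊥-elim (G∉D₀ (down-closed (D Fin.zero) H∈D₀ G⊆H))
    ... | Fin.suc i , H∈Dᵢ = i , H∈Dᵢ

  persistent-cover : ExcludedMiddle (suc ℓ) → ∀ {k} (D : Fin k → Complex X) →
                     K ⊑ ⋃ D → K ⊑ ⋃ (persistent K ∘ D)
  persistent-cover em D K⊑⋃D F∈K = persistent-cover-above em D F∈K λ G∈K _ → K⊑⋃D G∈K

module _ {ℓ} {X Y : Set ℓ} {K : Complex X} {L : Complex Y} (φ : FacetMap K L) where

  preimage : Complex Y → Complex X
  preimage M .Simplex F = ∃[ F∈K ] image {L = K} {L} (fun φ) {F} F∈K ∈ Simplex M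
  preimage M .down-closed (F∈K , φF∈M) G⊆F =
    down-closed K F∈K G⊆F , down-closed M φF∈M λ { (x , x∈G , eq) → x , G⊆F x∈G , eq }

  module _ (M : Complex Y) (M⊑L : M ⊑ L) where

    private
      P : Complex X
      P = persistent K (preimage M)

      P⊑K : P ⊑ K
      P⊑K = persistent-⊑ˡ K (preimage M)

      toK : Vertex P → Vertex K
      toK = refine (V-mono {K = K} {P} P⊑K)

      image∈M : ∀ {F} (F∈P : F ∈ Simplex P) → image {L = K} {L} (fun φ) (P⊑K F∈P) ∈ Simplex M
      -- Two different proofs that `F` is in `K` occur here, but `image` uses them only
      -- irrelevantly.
      image∈M F∈P = proj₂ (persistent-⊑ʳ K (preimage M) F∈P)

    restrict : FacetMap P M
    restrict .fun v@(x , x∈V) =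
      value (fun φ (toK v)) ,
      Irrelevant.map (λ { (F , F∈P , x∈F) → _ , image∈M F∈P , x , x∈F , refl }) x∈V
    restrict .simplicial = image∈M
    -- A facet of `P` is a facet of `K`, so `φ` sends a non-unitary one to a facet of `L`; as this
    -- image lies in `M ⊑ L`, it is a facet of `M` too.
    restrict .preservesNonUnitaryFacets F∈P (facet , nonUnitary) =
      let φfacet , φnonUnitary =
            preservesNonUnitaryFacets φ (P⊑K F∈P)
              (persistent-facet K (preimage M) facet , nonUnitary)
      in IsFacet-⊑ {K = L} {M} M⊑L (image∈M F∈P) φfacet , φnonUnitary

    restrict-injective : IsInjective φ → IsInjective restrict
    restrict-injective φ-inj eq =
      value-injective (cong value (φ-inj (value-injective (cong value eq))))

  -- `N` stands for having a facet map, injective or not, to a fixed complex, so one transfer serves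
  -- both complexities.
  CoverBy-preimage :
    ExcludedMiddle (suc ℓ) → (N : {Z : Set ℓ} → Complex Z → Set (suc ℓ)) →
    (∀ M → M ⊑ L → N M → N (persistent K (preimage M))) →
    CoverBy N L ⊆ CoverBy N K
  CoverBy-preimage em _ pull (Lᵢ , Lᵢ⊑L , (L⊑⋃ , _) , mᵢ) =
    (λ i → persistent K (preimage (Lᵢ i))) ,
    (λ i → persistent-⊑ˡ K (preimage (Lᵢ i))) ,
    ( persistent-cover K em (preimage ∘ Lᵢ)
        (λ F∈K → map₂ (F∈K ,_) (L⊑⋃ (simplicial φ F∈K)))
    , λ { (i , F∈P) → persistent-⊑ˡ K (preimage (Lᵢ i)) F∈P }) ,
    λ i → pull (Lᵢ i) (Lᵢ⊑L i) (mᵢ i)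

CoverBy-map : (L : Complex X) {N N′ : Complex X → Set _} →
              (∀ M → N′ M → N M) → CoverBy N′ L ⊆ CoverBy N L
CoverBy-map L f (Lᵢ , Lᵢ⊑L , L≈⋃ , mᵢ) = Lᵢ , Lᵢ⊑L , L≈⋃ , λ i → f (Lᵢ i) (mᵢ i)

theorem3p8 : {ℓ : Level} (em : ExcludedMiddle (suc (suc ℓ)))
    {X′ X Y′ Y : Set ℓ}
    (L′ : Complex X′) (L : Complex X) (H′ : Complex Y′) (H : Complex Y)
    (φ : FacetMap L′ L) (ψ : FacetMap H′ H) →
    (C em L′ H ≤⁺ C em L H × C em L H ≤⁺ C em L H′)
    × (IsInjective φ → IsInjective ψ →
    IC em L′ H ≤⁺ IC em L H × IC em L H ≤⁺ IC em L H′)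
theorem3p8 em L′ L H′ H φ ψ =
  -- Each transfer keeps the number of pieces, so `map₂` carries `0 < k` along.
  ( least-antitone em (map₂ (CoverBy-preimage φ (lower-em em) (λ M → FacetMap M H)
      λ M M⊑L f → f ∘ᶠ restrict φ M M⊑L))
  , least-antitone em (map₂ (CoverBy-map L λ M → _∘ᶠ_ {K = M} ψ))) ,
  λ φ-inj ψ-inj →
    least-antitone em (map₂ (CoverBy-preimage φ (lower-em em) (λ M → InjFacetMap M H)
      λ M M⊑L f → f ∘ⁱ (restrict φ M M⊑L , restrict-injective φ M M⊑L φ-inj))) ,
    least-antitone em (map₂ (CoverBy-map L λ M → _∘ⁱ_ {K = M} (ψ , ψ-inj)))
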